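{- Let $\mathcal{F}$ be the free non-symmetric operad on two binary generators $\alpha,\beta$, and let $\pi:\mathcal{F}\to\mathrm{CNCB}$ be the operad morphism with $\pi(\alpha)=\tau_{aab}$ and $\pi(\beta)=\tau_{bba}$. Then $\pi$ induces an isomorphism from $\mathcal{F}/_{\equiv}$ onto the suboperad $\langle\tau_{aab},\tau_{bba}\rangle$, where $\equiv$ is the smallest operad congruence of $\mathcal{F}$ containing $(\alpha\circ_2\alpha)\circ_2\beta\equiv(\alpha\circ_1\beta)\circ_1\alpha$ and $(\beta\circ_2\beta)\circ_2\alpha\equiv(\beta\circ_1\alpha)\circ_1\beta$.
   Context: A bicoloured noncrossing configuration (BNC) of size $n\ge2$ is a regular polygon with vertices $1,\dots,n+1$ (clockwise) with each arc $(i,j)$, $1\le i<j\le n+1$, coloured blue, red or uncoloured, such that no two coloured (blue or red) arcs cross and red arcs are diagonals. The edges are $(i,i+1)$ for $i\in[n]$ (the $i$-th edge), the base is $(1,n+1)$, and the other arcs are diagonals. There is also a unique BNC of size $1$, a single blue arc (its edge and base). $\mathrm{CNCB}$ is the non-symmetric operad of BNCs (arity = size, unit = the size-$1$ BNC) with composition $\mathfrak{C}\circ_i\mathfrak{D}$ ($\mathfrak{C}$ of size $n$, $\mathfrak{D}$ of size $m$) obtained by gluing the base of $\mathfrak{D}$ onto the $i$-th edge of $\mathfrak{C}$. Vertex $j$ of $\mathfrak{C}$ goes to $j$ if $j\le i$ and to $j+m-1$ otherwise, and vertex $\ell$ of $\mathfrak{D}$ goes to $i+\ell-1$. All other arcs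 keep their colours. The arc $(i,i+m)$ is red if the $i$-th edge of $\mathfrak{C}$ and the base of $\mathfrak{D}$ are both uncoloured, blue if both are blue, and uncoloured otherwise. All remaining arcs are uncoloured. For $x,y,z\in\{a,b\}$, $\tau_{xyz}$ is the BNC of size $2$ (a triangle, which has no diagonals) whose first edge $(1,2)$, base $(1,3)$ and second edge $(2,3)$ are respectively coloured $x,y,z$, where $a$ means blue and $b$ means uncoloured. $\langle G\rangle$ denotes the smallest suboperad of $\mathrm{CNCB}$ containing $G$. -}

module Defs where

open import Data.Nat using (ℕ; zero; suc; _+_; _∸_; _≤_; _<_; _≤ᵇ_; _≡ᵇ_)
open import Data.Bool using (Bool; true; false; if_then_else_; _∧_; _∨_)
open import Data.Product using (_×_; Σ; _,_)
open import Relation.Binary.PropositionalEquality using (_≡_)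

data Colour : Set where
  blue red none : Colour

-- A configuration of size n: vertices 1 .. n+1, and the colour of the arc
-- (i , j) is  col i j  for 1 ≤ i < j ≤ n+1 (values outside this range are
-- irrelevant, see _≈C_).
record Config : Set where
  constructor mkConfig
  field
    size : ℕ
    col  : ℕ → ℕ → Colour
open Config public

_≈C_ : Config → Config → Set
C ≈C D = (size C ≡ size D) ×
  (∀ i j → 1 ≤ i → i < j → j ≤ suc (size C) → col C i j ≡ col D i j)

glue : Colour → Colour → Colour
glue none none = red
glue blue blue = blue
glue _    _    = none

-- partial composition  C ∘_i D  in CNCB (gluing the base of D on the
-- i-th edge of C), for 1 ≤ i ≤ size C.
_∘C⟨_⟩_ : Config → ℕ → Config → Config
C ∘C⟨ i ⟩ D = mkConfig (size C + size D ∸ 1) c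
  where
    m = size D
    inD : ℕ → Bool
    inD x = (i ≤ᵇ x) ∧ (x ≤ᵇ i + m)
    inC : ℕ → Bool
    inC x = (x ≤ᵇ i) ∨ (i + m ≤ᵇ x)
    backC : ℕ → ℕ
    backC x = if x ≤ᵇ i then x else x ∸ (m ∸ 1)
    backD : ℕ → ℕ
    backD x = suc (x ∸ i)
    c : ℕ → ℕ → Colour
    c p q =
      if (p ≡ᵇ i) ∧ (q ≡ᵇ i + m)
      then glue (col C i (suc i)) (col D 1 (suc m))
      else (if inD p ∧ inD q
            then col D (backD p) (backD q)
            else (if inC p ∧ inC q
                  then col C (backC p) (backC q)
                  else none))

-- the unique BNC of size 1
unitC : Config
unitC = mkConfig 1 c
  where
    c : ℕ → ℕ → Colour
    c 1 2 = blue
    c _ _ = none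

data AB : Set where
  a b : AB

⟦_⟧ : AB → Colour
⟦ a ⟧ = blue
⟦ b ⟧ = none

-- τ_xyz : triangle with first edge (1,2) coloured x, base (1,3) coloured y,
-- second edge (2,3) coloured z
τ : AB → AB → AB → Config
τ x y z = mkConfig 2 c
  where
    c : ℕ → ℕ → Colour
    c 1 2 = ⟦ x ⟧
    c 1 3 = ⟦ y ⟧
    c 2 3 = ⟦ z ⟧
    c _ _ = none

data InGen : Config → Set where
  gen-unit : InGen unitC
  gen-aab  : InGen (τ a a b)
  gen-bba  : InGen (τ b b a)
  gen-comp : ∀ {C D} i → 1 ≤ i → i ≤ size C →
             InGen C → InGen D → InGen (C ∘C⟨ i ⟩ D)

data Gen₂ : Set where
  α β : Gen₂

-- syntax trees; node g l r stands for (g ∘₂ r) ∘₁ l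
data Tree : Set where
  leaf : Tree
  node : Gen₂ → Tree → Tree → Tree

arity : Tree → ℕ
arity leaf         = 1
arity (node _ l r) = arity l + arity r

-- partial composition s ∘_i t (grafting t on the i-th leaf), 1 ≤ i ≤ arity s
_∘T⟨_⟩_ : Tree → ℕ → Tree → Tree
leaf ∘T⟨ i ⟩ t = t
node g l r ∘T⟨ i ⟩ t =
  if i ≤ᵇ arity l then node g (l ∘T⟨ i ⟩ t) r
  else node g l (r ∘T⟨ i ∸ arity l ⟩ t)

gen : Gen₂ → Tree
gen g = node g leaf leaf

data _≡F_ : Tree → Tree → Set where
  rel-α  : ((gen α ∘T⟨ 2 ⟩ gen α) ∘T⟨ 2 ⟩ gen β) ≡F ((gen α ∘T⟨ 1 ⟩ gen β) ∘T⟨ 1 ⟩ gen α)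
  rel-β  : ((gen β ∘T⟨ 2 ⟩ gen β) ∘T⟨ 2 ⟩ gen α) ≡F ((gen β ∘T⟨ 1 ⟩ gen α) ∘T⟨ 1 ⟩ gen β)
  ≡F-refl  : ∀ {s} → s ≡F s
  ≡F-sym   : ∀ {s t} → s ≡F t → t ≡F s
  ≡F-trans : ∀ {s t u} → s ≡F t → t ≡F u → s ≡F u
  ≡F-comp  : ∀ {s s' t t'} i → 1 ≤ i → i ≤ arity s →
             s ≡F s' → t ≡F t' → (s ∘T⟨ i ⟩ t) ≡F (s' ∘T⟨ i ⟩ t')

πgen : Gen₂ → Config
πgen α = τ a a b
πgen β = τ b b a

π : Tree → Config
π leaf         = unitC
π (node g l r) = (πgen g ∘C⟨ 2 ⟩ π r) ∘C⟨ 1 ⟩ π l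

{-# OPTIONS --safe #-}
-- A tree α(l, r) or β(l, r) glued into an edge slot of its parent leaves an uncoloured
-- diagonal exactly when the two clash, so cutting a tree at its coloured diagonals splits it
-- into bubbles.  In a bubble the generators are forced by the position: below a node g the left
-- child is the opposite generator and the right child is g again, or else a letter (a leaf or a
-- coloured diagonal).  The relations read
--   g(x, g(g'(y, z), w)) = g(g'(g(x, y), z), w),   {g, g'} = {α, β},
-- and they preserve the word of letters on the border of the bubble.  Conversely, used from left
-- to right, they give normal forms which depend on this word only.  The configuration determines
-- the words of all bubbles, since the first letter of a bubble is the longest coloured diagonal
-- other than the base (or else the edge) issued from the source of the base.
module Submission where

open import Defs
open import Data.Bool using (true; false; if_then_else_; _∧_; _∨_)
open import Data.Bool.Properties using (∧-zeroʳ; ∨-zeroʳ)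
open import Data.List using (List; []; _∷_; _++_; foldr)
open import Data.List.Properties using (foldr-++)
open import Data.List.Relation.Unary.All using (All; []; _∷_)
open import Data.List.Relation.Unary.All.Properties using (++⁺)
open import Data.List.Relation.Binary.Pointwise using (Pointwise; []; _∷_)
open import Data.Nat using (ℕ; zero; suc; pred; _+_; _∸_; _≤_; _<_; _≤ᵇ_; _≡ᵇ_;
  z≤n; s≤s; s≤s⁻¹; z<s; _≤?_; _<?_)
open import Data.Nat.Properties
open import Data.Product using (_×_; Σ; _,_; proj₁; proj₂; ∃)
open import Function using (_∘_)
open import Function.Bundles using (_⇔_; mk⇔)
open import Relation.Nullary using (¬_; yes; no; contradiction)
open import Relation.Nullary.Decidable using (dec-true; dec-false)
open import Relation.Binary.PropositionalEquality

-- Arcs of a composite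

≤ᵇ-true : ∀ {x y} → x ≤ y → (x ≤ᵇ y) ≡ true
≤ᵇ-true {x} {y} = dec-true (x ≤? y)

≤ᵇ-false : ∀ {x y} → y < x → (x ≤ᵇ y) ≡ false
≤ᵇ-false {x} {y} = dec-false (x ≤? y) ∘ <⇒≱

≡ᵇ-true : ∀ {x y} → x ≡ y → (x ≡ᵇ y) ≡ true
≡ᵇ-true {x} {y} = dec-true (x ≟ y)

≡ᵇ-false : ∀ {x y} → x ≢ y → (x ≡ᵇ y) ≡ false
≡ᵇ-false {x} {y} = dec-false (x ≟ y)

∧-true : ∀ {x y} → x ≡ true → y ≡ true → (x ∧ y) ≡ true
∧-true refl refl = refl

∧-falseˡ : ∀ {x y} → x ≡ false → (x ∧ y) ≡ false
∧-falseˡ refl = refl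

∧-falseʳ : ∀ {x y} → y ≡ false → (x ∧ y) ≡ false
∧-falseʳ {x} refl = ∧-zeroʳ x

∨-trueˡ : ∀ {x y} → x ≡ true → (x ∨ y) ≡ true
∨-trueˡ refl = refl

∨-trueʳ : ∀ {x y} → y ≡ true → (x ∨ y) ≡ true
∨-trueʳ {x} refl = ∨-zeroʳ x

∨-false : ∀ {x y} → x ≡ false → y ≡ false → (x ∨ y) ≡ false
∨-false refl refl = refl

module _ {A : Set} where

  if-true : ∀ {b} {x y : A} → b ≡ true → (if b then x else y) ≡ x
  if-true refl = refl

  if-false : ∀ {b} {x y : A} → b ≡ false → (if b then x else y) ≡ y
  if-false refl = refl

-- Vertices and edges are numbered from 0 in proofs: p stands for vertex suc p of Defs.
-- Up i m x y: gluing a configuration of size suc m onto edge i moves vertex x of the outer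
-- configuration to y.
data Up (i m x y : ℕ) : Set where
  low  : x ≤ i → y ≡ x → Up i m x y
  high : i < x → y ≡ m + x → Up i m x y

-- The cases follow the branches of the colouring in `_∘C⟨_⟩_`, the last branch being split
-- according to the side on which the arc leaves the glued polygon. The negations in `inside` and
-- `outside` exclude the glued arc, which belongs to both polygons.
data Place (i m p q : ℕ) : Set where
  glued     : p ≡ i → q ≡ i + suc m → Place i m p q
  inside    : ∀ p′ q′ → p ≡ i + p′ → q ≡ i + q′ → p′ < q′ → q′ ≤ suc m →
              ¬ (p′ ≡ 0 × q′ ≡ suc m) → Place i m p q
  outside   : ∀ p′ q′ → Up i m p′ p → Up i m q′ q → p′ < q′ →
              ¬ (p′ ≡ i × q′ ≡ suc i) → Place i m p q
  crossing-right : i < p → p < i + suc m → i + suc m < q → Place i m p q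
  crossing-left  : p < i → i < q → q < i + suc m → Place i m p q

from-≤ : ∀ {x y} → x ≤ y → ∃ λ d → y ≡ x + d
from-≤ le = _ , sym (proj₂ (m≤n⇒∃[o]m+o≡n le))

high-up : ∀ {i m y} → i + suc m ≤ y → ∃ λ x → i < x × y ≡ m + x
high-up {i} {m} le with from-≤ le
... | d , refl = suc i + d , s≤s (m≤m+n i d) , (begin
    i + suc m + d   ≡⟨ cong (_+ d) (trans (+-suc i m) (cong suc (+-comm i m))) ⟩
    suc (m + i) + d ≡⟨ cong (_+ d) (sym (+-suc m i)) ⟩
    m + suc i + d   ≡⟨ +-assoc m (suc i) d ⟩
    m + (suc i + d) ∎)
  where open ≡-Reasoning

i+1+m : ∀ i m → i + suc m ≡ m + suc i
i+1+m i m = trans (+-suc i m) (trans (cong suc (+-comm i m)) (sym (+-suc m i)))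

place : ∀ i m p q → p < q → Place i m p q
place i m p q p<q with p ≤? i
... | yes p≤i with q ≤? i
...   | yes q≤i = outside p q (low p≤i refl) (low q≤i refl) p<q
                    λ { (_ , refl) → 1+n≰n q≤i }
...   | no q≰i with i + suc m ≤? q
...     | yes le with high-up le | p ≟ i | q ≟ i + suc m
...       | _ | yes p≡i | yes q≡ = glued p≡i q≡
...       | x , i<x , q≡m+x | yes p≡i | no q≢ =
            outside p x (low p≤i refl) (high i<x q≡m+x) (≤-<-trans p≤i i<x)
              λ { (_ , refl) → q≢ (trans q≡m+x (sym (i+1+m i m))) }
...       | x , i<x , q≡m+x | no p≢i | _ =
            outside p x (low p≤i refl) (high i<x q≡m+x) (≤-<-trans p≤i i<x) (p≢i ∘ proj₁)
place i m p q p<q | yes p≤i | no q≰i | no nle with p ≟ i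
... | no p≢i = crossing-left (≤∧≢⇒< p≤i p≢i) (≰⇒> q≰i) (≰⇒> nle)
... | yes refl with from-≤ (<⇒≤ p<q)
...   | d , refl = inside 0 d (sym (+-identityʳ p)) refl
                     (+-cancelˡ-< p 0 d (subst (_< p + d) (sym (+-identityʳ p)) p<q))
                     (<⇒≤ d<) λ { (_ , refl) → <-irrefl refl d< }
  where d< = +-cancelˡ-< p d (suc m) (≰⇒> nle)
place i m p q p<q | no p≰i with i + suc m ≤? p
... | yes le with high-up le | high-up (≤-trans le (<⇒≤ p<q))
...   | x , i<x , refl | y , i<y , refl =
        outside x y (high i<x refl) (high i<y refl) (+-cancelˡ-< m x y p<q)
          λ { (refl , _) → <-irrefl refl i<x }
place i m p q p<q | no p≰i | no nle with q ≤? i + suc m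
... | no q≰ = crossing-right (≰⇒> p≰i) (≰⇒> nle) (≰⇒> q≰)
... | yes q≤ with from-≤ (<⇒≤ (≰⇒> p≰i)) | from-≤ (<⇒≤ (<-trans (≰⇒> p≰i) p<q))
...   | x , refl | y , refl =
        inside x y refl refl (+-cancelˡ-< i x y p<q) (+-cancelˡ-≤ i y (suc m) q≤)
          λ { (refl , _) → p≰i (≤-reflexive (+-identityʳ i)) }

-- The size of `D` has the form `suc m` because the outer vertices beyond the glued edge move by
-- `m`; this keeps truncated subtraction out of the statements.
module Composite (C D : Config) (i m : ℕ) (size-D : size D ≡ suc m) where

  K : ℕ → ℕ → Colour
  K p q = col (C ∘C⟨ suc i ⟩ D) (suc p) (suc q)

  i+D : suc i + size D ≡ suc (i + suc m)
  i+D = cong (λ z → suc (i + z)) size-D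

  private
    ≤D : ∀ {x} → x ≤ i + suc m → (suc x ≤ᵇ suc i + size D) ≡ true
    ≤D {x} le = ≤ᵇ-true (subst (suc x ≤_) (sym i+D) (s≤s le))

    ≰D : ∀ {x} → i + suc m < x → (suc x ≤ᵇ suc i + size D) ≡ false
    ≰D {x} lt = ≤ᵇ-false (subst (_< suc x) (sym i+D) (s≤s lt))

    D≤ : ∀ {x} → i + suc m ≤ x → (suc i + size D ≤ᵇ suc x) ≡ true
    D≤ {x} le = ≤ᵇ-true (subst (_≤ suc x) (sym i+D) (s≤s le))

    D≰ : ∀ {x} → x < i + suc m → (suc i + size D ≤ᵇ suc x) ≡ false
    D≰ {x} lt = ≤ᵇ-false (subst (suc x <_) (sym i+D) (s≤s lt))

    ≢D : ∀ {x} → x ≢ i + suc m → (suc x ≡ᵇ suc i + size D) ≡ false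
    ≢D ne = ≡ᵇ-false (ne ∘ suc-injective ∘ λ e → trans e i+D)

    not-glued : ∀ {p q} → ¬ (p ≡ i × q ≡ i + suc m) →
                ((suc p ≡ᵇ suc i) ∧ (suc q ≡ᵇ suc i + size D)) ≡ false
    not-glued {p} {q} ne with p ≟ i
    ... | no p≢i   = ∧-falseˡ (≡ᵇ-false (p≢i ∘ suc-injective))
    ... | yes p≡i  = ∧-falseʳ {suc p ≡ᵇ suc i} (≢D (λ e → ne (p≡i , e)))

    notD : ∀ {p q} → p < q → ¬ (i ≤ p × q ≤ i + suc m) →
           (((suc i ≤ᵇ suc p) ∧ (suc p ≤ᵇ suc i + size D)) ∧
            ((suc i ≤ᵇ suc q) ∧ (suc q ≤ᵇ suc i + size D))) ≡ false
    notD {p} {q} p<q ne with i ≤? p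
    ... | no i≰p  = ∧-falseˡ (∧-falseˡ (≤ᵇ-false (s≤s (≰⇒> i≰p))))
    ... | yes i≤p = ∧-falseʳ {(suc i ≤ᵇ suc p) ∧ (suc p ≤ᵇ suc i + size D)}
                      (∧-falseʳ {suc i ≤ᵇ suc q} (≰D (≰⇒> λ q≤ → ne (i≤p , q≤))))

  K-glued : ∀ {p q} → p ≡ i → q ≡ i + suc m →
            K p q ≡ glue (col C (suc i) (suc (suc i))) (col D 1 (suc (suc m)))
  K-glued refl refl =
    trans (if-true (∧-true (≡ᵇ-true {suc i} refl) (≡ᵇ-true (sym i+D))))
          (cong (λ z → glue (col C (suc i) (suc (suc i))) (col D 1 (suc z))) size-D)

  K-inside : ∀ {p q} p′ q′ → p ≡ i + p′ → q ≡ i + q′ → p′ < q′ → q′ ≤ suc m →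
             ¬ (p′ ≡ 0 × q′ ≡ suc m) → K p q ≡ col D (suc p′) (suc q′)
  K-inside p′ q′ refl refl p<q q≤ ne =
    trans (if-false (not-glued λ { (e , e′) → ne
             ( +-cancelˡ-≡ i p′ 0 (trans e (sym (+-identityʳ i)))
             , +-cancelˡ-≡ i q′ (suc m) e′ ) }))
    (trans (if-true (∧-true
             (∧-true (≤ᵇ-true (s≤s (m≤m+n i p′))) (≤D (+-monoʳ-≤ i (≤-trans (<⇒≤ p<q) q≤))))
             (∧-true (≤ᵇ-true (s≤s (m≤m+n i q′))) (≤D (+-monoʳ-≤ i q≤)))))
      (cong₂ (λ x y → col D (suc x) (suc y)) (m+n∸m≡n i p′) (m+n∸m≡n i q′)))

  private
    inC : ∀ {x y} → Up i m x y → ((suc y ≤ᵇ suc i) ∨ (suc i + size D ≤ᵇ suc y)) ≡ true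
    inC (low x≤i refl) = ∨-trueˡ (≤ᵇ-true (s≤s x≤i))
    inC {x} {y} (high i<x refl) = ∨-trueʳ {suc y ≤ᵇ suc i}
      (D≤ (subst (_≤ m + x) (sym (i+1+m i m)) (+-monoʳ-≤ m i<x)))

    back : ∀ {x y} → Up i m x y →
           (if suc y ≤ᵇ suc i then suc y else suc y ∸ (size D ∸ 1)) ≡ suc x
    back (low x≤i refl) = if-true (≤ᵇ-true (s≤s x≤i))
    back {x} (high i<x refl) =
      trans (if-false (≤ᵇ-false (s≤s (<-≤-trans i<x (m≤n+m x m)))))
      (trans (cong (λ z → suc (m + x) ∸ (z ∸ 1)) size-D)
      (trans (cong (_∸ m) (sym (+-suc m x))) (m+n∸m≡n m (suc x))))

    interior : ∀ {x} → i < x → x < i + suc m →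
               ((suc x ≤ᵇ suc i) ∨ (suc i + size D ≤ᵇ suc x)) ≡ false
    interior i<x x< = ∨-false (≤ᵇ-false (s≤s i<x)) (D≰ x<)

    -- The images of outer vertices meet the range of `D` only in the two ends of the glued edge.
    out-of-D : ∀ {x y p q} → Up i m x p → Up i m y q → x < y →
               ¬ (x ≡ i × y ≡ suc i) → ¬ (i ≤ p × q ≤ i + suc m)
    out-of-D (low x≤i refl) (low y≤i refl) x<y _ (i≤p , _) =
      <⇒≱ (<-≤-trans x<y y≤i) i≤p
    out-of-D {x} {y} (low x≤i refl) (high i<y refl) x<y ne (i≤x , q≤) =
      ne (≤-antisym x≤i i≤x , ≤-antisym (+-cancelˡ-≤ m y (suc i) (subst (m + y ≤_) (i+1+m i m) q≤)) i<y)
    out-of-D (high i<x refl) (low y≤i refl) x<y _ _ = <⇒≱ (<-trans i<x x<y) y≤i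
    out-of-D {x} {y} (high i<x refl) (high i<y refl) x<y _ (_ , q≤) =
      <⇒≱ (≤-<-trans i<x x<y) (+-cancelˡ-≤ m y (suc i) (subst (m + y ≤_) (i+1+m i m) q≤))

  Up-mono : ∀ {x y p q} → Up i m x p → Up i m y q → x < y → p < q
  Up-mono (low _ refl) (low _ refl) x<y = x<y
  Up-mono {y = y} (low _ refl) (high _ refl) x<y = <-≤-trans x<y (m≤n+m y m)
  Up-mono (high i<x refl) (low y≤i refl) x<y = contradiction y≤i (<⇒≱ (<-trans i<x x<y))
  Up-mono (high _ refl) (high _ refl) x<y = +-monoʳ-< m x<y

  K-outside : ∀ {p q} p′ q′ → Up i m p′ p → Up i m q′ q → p′ < q′ →
              ¬ (p′ ≡ i × q′ ≡ suc i) → K p q ≡ col C (suc p′) (suc q′)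
  K-outside p′ q′ u v p<q ne =
    trans (if-false (not-glued λ { (e , e′) → out-of-D u v p<q ne (≤-reflexive (sym e) , ≤-reflexive e′) }))
    (trans (if-false (notD (Up-mono u v p<q) (out-of-D u v p<q ne)))
    (trans (if-true (∧-true (inC u) (inC v))) (cong₂ (col C) (back u) (back v))))

  K-crossing-right : ∀ {p q} → i < p → p < i + suc m → i + suc m < q → K p q ≡ none
  K-crossing-right {p} {q} i<p p< <q =
    trans (if-false (not-glued {p} {q} λ { (_ , refl) → <-irrefl refl <q }))
    (trans (if-false (notD (<-trans p< <q) (<⇒≱ <q ∘ proj₂)))
    (if-false (∧-falseˡ (interior i<p p<))))

  K-crossing-left : ∀ {p q} → p < i → i < q → q < i + suc m → K p q ≡ none
  K-crossing-left {p} {q} p<i i<q q< =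
    trans (if-false (not-glued {p} {q} λ { (refl , _) → <-irrefl refl p<i }))
    (trans (if-false (notD (<-trans p<i i<q) (<⇒≱ p<i ∘ proj₁)))
    (if-false (∧-falseʳ {(suc p ≤ᵇ suc i) ∨ (suc i + size D ≤ᵇ suc p)} (interior i<q q<))))

Up-shift : ∀ o {i m x y} → Up i m x y → Up (o + i) m (o + x) (o + y)
Up-shift o (low x≤i refl) = low (+-monoʳ-≤ o x≤i) refl
Up-shift o {m = m} {x} (high i<x refl) = high (+-monoʳ-< o i<x)
  (trans (sym (+-assoc o m x)) (trans (cong (_+ x) (+-comm o m)) (+-assoc m o x)))

Up-bound : ∀ {i m n x y} → Up i m x y → i < n → y ≤ n + m → x ≤ n
Up-bound (low x≤i _) i<n _ = ≤-trans x≤i (<⇒≤ i<n)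
Up-bound {m = m} {n} {x} (high _ refl) _ le = +-cancelˡ-≤ m x n (subst (m + x ≤_) (+-comm n m) le)

Up-bound-< : ∀ {i m n x y} → Up i m x y → i < n → y < n + m → x < n
Up-bound-< (low x≤i _) i<n _ = ≤-<-trans x≤i i<n
Up-bound-< {m = m} {n} {x} (high _ refl) _ lt = +-cancelˡ-< m x n (subst (m + x <_) (+-comm n m) lt)

Up-lower : ∀ {i m n x y} → Up i m x y → i < n → n + m < y → n < x
Up-lower {m = m} {n} (low x≤i refl) i<n lt =
  contradiction lt (≤⇒≯ (≤-trans x≤i (≤-trans (<⇒≤ i<n) (m≤m+n n m))))
Up-lower {m = m} {n} {x} (high _ refl) _ lt = +-cancelˡ-< m n x (subst (_< m + x) (+-comm n m) lt)

Up-zero : ∀ {i m y} → Up i m 0 y → y ≡ 0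
Up-zero (low _ e) = e

Up-high : ∀ {i m x y} → Up i m x y → i < x → y ≡ m + x
Up-high (low x≤i _) i<x = contradiction x≤i (<⇒≱ i<x)
Up-high (high _ e)  _   = e

-- Gluing is local: `C′` is the part of `C` on the `n + 1` vertices from `o` on, and if the glued
-- edge lies in this window, a vertex of the window is placed alike on both sides. A left subtree is
-- the window with `o = 0`, a right subtree the one with `o` the arity of its left sibling. With the
-- whole polygon as window, the lemma says that gluing respects `_≈C_`.
composite-local : ∀ o {n i m} C C′ D D′ → size D ≡ suc m → size D′ ≡ suc m → i < n →
  (∀ p q → p < q → q ≤ n → col C (suc (o + p)) (suc (o + q)) ≡ col C′ (suc p) (suc q)) →
  (∀ p q → p < q → q ≤ suc m → col D (suc p) (suc q) ≡ col D′ (suc p) (suc q)) →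
  ∀ p q → p < q → q ≤ n + m →
  col (C ∘C⟨ suc (o + i) ⟩ D) (suc (o + p)) (suc (o + q)) ≡ col (C′ ∘C⟨ suc i ⟩ D′) (suc p) (suc q)
composite-local o {n} {i} {m} C C′ D D′ sD sD′ i<n CC DD p q p<q q≤
  with place i m p q p<q
... | glued refl refl =
  trans (L.K-glued refl (sym (+-assoc o i (suc m))))
  (trans (cong₂ glue (trans (cong (λ z → col C (suc (o + i)) (suc z)) (sym (+-suc o i)))
                            (CC i (suc i) ≤-refl i<n))
                     (DD 0 (suc m) z<s ≤-refl))
  (sym (R.K-glued refl refl)))
  where module L = Composite C D (o + i) m sD
        module R = Composite C′ D′ i m sD′
... | inside x y refl refl x<y y≤ ne =
  trans (L.K-inside x y (sym (+-assoc o i x)) (sym (+-assoc o i y)) x<y y≤ ne)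
  (trans (DD x y x<y y≤) (sym (R.K-inside x y refl refl x<y y≤ ne)))
  where module L = Composite C D (o + i) m sD
        module R = Composite C′ D′ i m sD′
... | outside x y u v x<y ne =
  trans (L.K-outside (o + x) (o + y) (Up-shift o u) (Up-shift o v) (+-monoʳ-< o x<y)
          λ { (e , e′) → ne (+-cancelˡ-≡ o x i e , +-cancelˡ-≡ o y (suc i) (trans e′ (sym (+-suc o i)))) })
  (trans (CC x y x<y (Up-bound v i<n q≤)) (sym (R.K-outside x y u v x<y ne)))
  where module L = Composite C D (o + i) m sD
        module R = Composite C′ D′ i m sD′
... | crossing-right i<p p< <q =
  trans (L.K-crossing-right (+-monoʳ-< o i<p) (subst (o + p <_) (sym (+-assoc o i _)) (+-monoʳ-< o p<))
          (subst (_< o + q) (sym (+-assoc o i _)) (+-monoʳ-< o <q)))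
  (sym (R.K-crossing-right i<p p< <q))
  where module L = Composite C D (o + i) m sD
        module R = Composite C′ D′ i m sD′
... | crossing-left p<i i<q q< =
  trans (L.K-crossing-left (+-monoʳ-< o p<i) (+-monoʳ-< o i<q)
          (subst (o + q <_) (sym (+-assoc o i _)) (+-monoʳ-< o q<)))
  (sym (R.K-crossing-left p<i i<q q<))
  where module L = Composite C D (o + i) m sD
        module R = Composite C′ D′ i m sD′

-- Arcs of a tree

flip : Gen₂ → Gen₂
flip α = β
flip β = α

-- slot g: the colour of the edges onto which right children of g and left children of flip g are
-- glued; arcs g t: the arcs of t glued onto such an edge.
slot : Gen₂ → Colour
slot α = none
slot β = blue

base : Gen₂ → Colour
base α = blue
base β = none

juxtapose : ℕ → (ℕ → ℕ → Colour) → (ℕ → ℕ → Colour) → ℕ → ℕ → Colour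
juxtapose n f h p q =
  if q ≤ᵇ n then f p q else if n ≤ᵇ p then h (p ∸ n) (q ∸ n) else none

arcs : Gen₂ → Tree → ℕ → ℕ → Colour
arcs g leaf         p q = slot g
arcs g (node h l r) p q =
  if (p ≡ᵇ 0) ∧ (q ≡ᵇ arity l + arity r) then glue (slot g) (base h)
  else juxtapose (arity l) (arcs (flip h) l) (arcs h r) p q

arity-suc : ∀ t → ∃ λ m → arity t ≡ suc m
arity-suc leaf         = 0 , refl
arity-suc (node _ l r) with arity-suc l
... | m , e = m + arity r , cong (_+ arity r) e

0<arity : ∀ t → 0 < arity t
0<arity t with arity-suc t
... | m , e = subst (0 <_) (sym e) z<s

data Cut (n p q : ℕ) : Set where
  left   : q ≤ n → Cut n p q
  right  : ∀ p′ q′ → p ≡ n + p′ → q ≡ n + q′ → p′ < q′ → Cut n p q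
  across : p < n → n < q → Cut n p q

cut : ∀ n {p q} → p < q → Cut n p q
cut n {p} {q} p<q with q ≤? n | n ≤? p
... | yes q≤n | _ = left q≤n
... | no q≰n | no n≰p = across (≰⇒> n≰p) (≰⇒> q≰n)
... | no q≰n | yes n≤p with from-≤ n≤p | from-≤ (≤-trans n≤p (<⇒≤ p<q))
...   | x , refl | y , refl = right x y refl refl (+-cancelˡ-< n x y p<q)

module _ (f h : ℕ → ℕ → Colour) where

  juxtapose-left : ∀ {n p q} → q ≤ n → juxtapose n f h p q ≡ f p q
  juxtapose-left q≤n = if-true (≤ᵇ-true q≤n)

  juxtapose-right : ∀ n {p q} → p < q → juxtapose n f h (n + p) (n + q) ≡ h p q
  juxtapose-right n {p} {q} p<q =
    trans (if-false (≤ᵇ-false (m<m+n n (≤-<-trans z≤n p<q))))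
    (trans (if-true (≤ᵇ-true (m≤m+n n p))) (cong₂ h (m+n∸m≡n n p) (m+n∸m≡n n q)))

  juxtapose-across : ∀ {n p q} → p < n → n < q → juxtapose n f h p q ≡ none
  juxtapose-across p<n n<q = trans (if-false (≤ᵇ-false n<q)) (if-false (≤ᵇ-false p<n))

arcs-base : ∀ g h l r → arcs g (node h l r) 0 (arity l + arity r) ≡ glue (slot g) (base h)
arcs-base g h l r = if-true (≡ᵇ-true {arity l + arity r} refl)

arcs-inner : ∀ g h l r {p q} → ¬ (p ≡ 0 × q ≡ arity l + arity r) →
  arcs g (node h l r) p q ≡ juxtapose (arity l) (arcs (flip h) l) (arcs h r) p q
arcs-inner g h l r {zero}  ne = if-false (≡ᵇ-false λ e → ne (refl , e))
arcs-inner g h l r {suc p} ne = refl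

arcs-left : ∀ g h l r {p q} → q ≤ arity l → arcs g (node h l r) p q ≡ arcs (flip h) l p q
arcs-left g h l r {p} {q} q≤ =
  trans (arcs-inner g h l r {p} {q} λ { (_ , refl) → <⇒≱ (m<m+n (arity l) (0<arity r)) q≤ })
        (juxtapose-left (arcs (flip h) l) (arcs h r) q≤)

arcs-right : ∀ g h l r {p q} → p < q →
  arcs g (node h l r) (arity l + p) (arity l + q) ≡ arcs h r p q
arcs-right g h l r {p} {q} p<q =
  trans (arcs-inner g h l r {arity l + p} {arity l + q} λ { (e , _) → <-irrefl (sym (m+n≡0⇒m≡0 (arity l) e)) (0<arity l) })
        (juxtapose-right (arcs (flip h) l) (arcs h r) (arity l) p<q)

arcs-across : ∀ g h l r {p q} → p < arity l → arity l < q → ¬ (p ≡ 0 × q ≡ arity l + arity r) →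
  arcs g (node h l r) p q ≡ none
arcs-across g h l r p< <q ne =
  trans (arcs-inner g h l r ne) (juxtapose-across (arcs (flip h) l) (arcs h r) p< <q)

-- `config β t` is a closed form of `π t`: the slot of `β` is blue, like the unit, and gluing onto a
-- blue edge preserves the colour of a base, which is blue or uncoloured.
config : Gen₂ → Tree → Config
config g t = mkConfig (arity t) λ p q → arcs g t (pred p) (pred q)

-- Grafting of trees as gluing of configurations

graft-left : ∀ g l r t {i} → i < arity l →
  node g l r ∘T⟨ suc i ⟩ t ≡ node g (l ∘T⟨ suc i ⟩ t) r
graft-left g l r t i< = if-true (≤ᵇ-true i<)

graft-right : ∀ g l r t j →
  node g l r ∘T⟨ suc (arity l + j) ⟩ t ≡ node g l (r ∘T⟨ suc j ⟩ t)
graft-right g l r t j =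
  trans (if-false (≤ᵇ-false (s≤s (m≤m+n (arity l) j))))
        (cong (λ z → node g l (r ∘T⟨ z ⟩ t))
              (trans (cong (_∸ arity l) (sym (+-suc (arity l) j))) (m+n∸m≡n (arity l) (suc j))))

data Side (n m i : ℕ) : Set where
  left  : i < n → Side n m i
  right : ∀ j → i ≡ n + j → j < m → Side n m i

side : ∀ n m i → i < n + m → Side n m i
side n m i i< with i <? n
... | yes i<n = left i<n
... | no i≮n with from-≤ (≮⇒≥ i≮n)
...   | j , refl = right j refl (+-cancelˡ-< n j m i<)

arity-graft : ∀ s i t {m} → arity t ≡ suc m → i < arity s → arity (s ∘T⟨ suc i ⟩ t) ≡ arity s + m
arity-graft leaf i t e _ = e
arity-graft (node g l r) i t {m} e i< with side (arity l) (arity r) i i<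
... | left i<l = trans (cong arity (graft-left g l r t i<l))
        (trans (cong (_+ arity r) (arity-graft l i t e i<l))
        (trans (+-assoc (arity l) m (arity r))
        (trans (cong (arity l +_) (+-comm m (arity r))) (sym (+-assoc (arity l) (arity r) m)))))
... | right j refl j< = trans (cong arity (graft-right g l r t j))
        (trans (cong (arity l +_) (arity-graft r j t e j<)) (sym (+-assoc (arity l) (arity r) m)))

glue-slot : ∀ g h → glue (slot g) (glue blue (base h)) ≡ glue (slot g) (base h)
glue-slot g α = refl
glue-slot g β = refl

arcs-slot : ∀ g h t {p q} → ¬ (p ≡ 0 × q ≡ arity t) → p < q → q ≤ arity t →
  arcs g t p q ≡ arcs h t p q
arcs-slot g h leaf ne (s≤s z≤n) (s≤s z≤n) = contradiction (refl , refl) ne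
arcs-slot g h (node k l r) ne _ _ = trans (arcs-inner g k l r ne) (sym (arcs-inner h k l r ne))

arcs-top : ∀ g t → glue (slot g) (arcs β t 0 (arity t)) ≡ arcs g t 0 (arity t)
arcs-top α leaf = refl
arcs-top β leaf = refl
arcs-top g (node h l r) =
  trans (cong (glue (slot g)) (arcs-base β h l r)) (trans (glue-slot g h) (sym (arcs-base g h l r)))

-- Induction on `s`. At a leaf the slot edge meets the base of `t`, which is `arcs-top`. At a node
-- the graft happens within one subtree, where `composite-local` transports the induction
-- hypothesis. The arcs of the other subtree are at most translated, the base of `s` keeps its
-- colour, and the remaining arcs run across the two subtrees and are uncoloured on both sides.
graft-arcs : ∀ g s i t {m} → arity t ≡ suc m → i < arity s → ∀ p q → p < q → q ≤ arity s + m →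
  arcs g (s ∘T⟨ suc i ⟩ t) p q ≡ col (config g s ∘C⟨ suc i ⟩ config β t) (suc p) (suc q)
graft-arcs g leaf zero t {m} e _ p q p<q q≤ with p ≟ 0 | q ≟ suc m
... | yes refl | yes refl = sym (trans (K-glued refl refl)
        (subst (λ z → glue (slot g) (arcs β t 0 z) ≡ arcs g t 0 z) e (arcs-top g t)))
  where open Composite (config g leaf) (config β t) 0 m e
... | yes refl | no q≢ = trans (arcs-slot g β t (λ { (_ , refl) → q≢ e }) p<q (subst (q ≤_) (sym e) q≤))
        (sym (K-inside 0 q refl refl p<q q≤ (q≢ ∘ proj₂)))
  where open Composite (config g leaf) (config β t) 0 m e
... | no p≢ | _ = trans (arcs-slot g β t (p≢ ∘ proj₁) p<q (subst (q ≤_) (sym e) q≤))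
        (sym (K-inside p q refl refl p<q q≤ (p≢ ∘ proj₁)))
  where open Composite (config g leaf) (config β t) 0 m e
graft-arcs g leaf (suc i) t e (s≤s ()) p q
graft-arcs g s@(node h l r) i t {m} e i< p q p<q q≤ with side (arity l) (arity r) i i<
... | left i<l = trans (cong (λ z → arcs g z p q) (graft-left h l r t i<l)) (go (cut (arity l + m) p<q))
  where
  open Composite (config g s) (config β t) i m e
  l′ = l ∘T⟨ suc i ⟩ t
  al′ : arity l′ ≡ arity l + m
  al′ = arity-graft l i t e i<l
  i+m≤ : i + suc m ≤ arity l + m
  i+m≤ = subst (_≤ arity l + m) (sym (+-suc i m)) (+-monoˡ-≤ m i<l)
  size≡ : arity l′ + arity r ≡ m + (arity l + arity r)
  size≡ = trans (cong (_+ arity r) (trans al′ (+-comm (arity l) m))) (+-assoc m (arity l) (arity r))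

  -- The glued polygon lies within the left part. An arc which ends beyond that part therefore
  -- either crosses the border of the glued polygon or comes from an arc of `s`, and the latter runs
  -- across the subtrees of `s` as well.
  interior : p < arity l + m → arity l + m < q → ¬ (p ≡ 0 × q ≡ m + (arity l + arity r)) →
             arcs g (node h l′ r) p q ≡ K p q
  interior p<l l<q ne =
    trans (arcs-across g h l′ r (subst (p <_) (sym al′) p<l) (subst (_< q) (sym al′) l<q)
             λ { (e₁ , e₂) → ne (e₁ , trans e₂ size≡) })
          (sym (colourless (place i m p q p<q)))
    where
    i+m<q : i + suc m < q
    i+m<q = ≤-<-trans i+m≤ l<q
    colourless : Place i m p q → K p q ≡ none
    colourless (glued _ refl) = contradiction i+m<q (<-irrefl refl)
    colourless (inside x y _ refl _ y≤ _) = contradiction i+m<q (≤⇒≯ (+-monoʳ-≤ i y≤))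
    colourless (outside x y u v x<y ne′) = trans (K-outside x y u v x<y ne′)
      (arcs-across g h l r (Up-bound-< u i<l p<l) (Up-lower v i<l l<q)
        λ { (refl , refl) → ne (Up-zero u , Up-high v (≤-trans i<l (m≤m+n _ _))) })
    colourless (crossing-right x y z) = K-crossing-right x y z
    colourless (crossing-left x y z)  = K-crossing-left x y z

  go : Cut (arity l + m) p q → arcs g (node h l′ r) p q ≡ K p q
  go (left q≤l) =
    trans (arcs-left g h l′ r (subst (q ≤_) (sym al′) q≤l))
    (trans (graft-arcs (flip h) l i t e i<l p q p<q q≤l)
    (sym (composite-local 0 (config g s) (config (flip h) l) (config β t) (config β t) e e i<l
           (λ x y _ y≤ → arcs-left g h l r y≤) (λ _ _ _ _ → refl) p q p<q q≤l)))
  go (right x y refl refl x<y) =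
    trans (cong₂ (arcs g (node h l′ r)) (cong (_+ x) (sym al′)) (cong (_+ y) (sym al′)))
    (trans (arcs-right g h l′ r x<y)
    (trans (sym (arcs-right g h l r x<y))
    (sym (K-outside (arity l + x) (arity l + y)
           (high (<-≤-trans i<l (m≤m+n _ x)) (shift x))
           (high (<-≤-trans i<l (m≤m+n _ y)) (shift y))
           (+-monoʳ-< (arity l) x<y)
           λ { (e , _) → <⇒≱ i<l (≤-trans (m≤m+n _ x) (≤-reflexive e)) }))))
    where
    shift : ∀ z → arity l + m + z ≡ m + (arity l + z)
    shift z = trans (cong (_+ z) (+-comm (arity l) m)) (+-assoc m (arity l) z)
  go (across p<l l<q) with p ≟ 0 | q ≟ m + (arity l + arity r)
  ... | yes refl | yes refl =
        trans (cong (arcs g (node h l′ r) 0) (sym size≡))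
        (trans (arcs-base g h l′ r) (trans (sym (arcs-base g h l r))
        (sym (K-outside 0 (arity l + arity r) (low z≤n refl)
           (high (≤-trans i<l (m≤m+n _ _)) refl)
           (≤-trans (0<arity l) (m≤m+n _ _))
           λ { (refl , e) → <-irrefl (sym e) (+-mono-≤ (0<arity l) (0<arity r)) }))))
  ... | yes refl | no q≢ = interior p<l l<q (q≢ ∘ proj₂)
  ... | no p≢    | _     = interior p<l l<q (p≢ ∘ proj₁)
... | right j refl j< = trans (cong (λ z → arcs g z p q) (graft-right h l r t j)) (go (cut (arity l) p<q))
  where
  open Composite (config g s) (config β t) (arity l + j) m e
  r′ = r ∘T⟨ suc j ⟩ t
  ar′ : arity r′ ≡ arity r + m
  ar′ = arity-graft r j t e j<
  size≡ : arity l + arity r′ ≡ m + (arity l + arity r)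
  size≡ = trans (cong (arity l +_) ar′) (trans (sym (+-assoc (arity l) (arity r) m)) (+-comm _ m))
  q≤′ : q ≤ arity l + (arity r + m)
  q≤′ = subst (q ≤_) (+-assoc (arity l) (arity r) m) q≤

  interior : p < arity l → arity l < q → ¬ (p ≡ 0 × q ≡ m + (arity l + arity r)) →
             arcs g (node h l r′) p q ≡ K p q
  interior p<l l<q ne =
    trans (arcs-across g h l r′ p<l l<q λ { (e₁ , e₂) → ne (e₁ , trans e₂ size≡) })
          (sym (colourless (place (arity l + j) m p q p<q)))
    where
    p<i : p < arity l + j
    p<i = <-≤-trans p<l (m≤m+n _ j)
    colourless : Place (arity l + j) m p q → K p q ≡ none
    colourless (glued refl _) = contradiction p<i (<-irrefl refl)
    colourless (inside x _ refl _ _ _ _) = contradiction p<i (≤⇒≯ (m≤m+n _ x))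
    colourless (outside x y u v x<y ne′) = trans (K-outside x y u v x<y ne′)
      (arcs-across g h l r (source u) (target v)
        λ { (refl , refl) → ne (Up-zero u , Up-high v (+-monoʳ-< (arity l) j<)) })
      where
      source : Up (arity l + j) m x p → x < arity l
      source (low _ refl) = p<l
      source (high i<x refl) = contradiction p<i (≤⇒≯ (≤-trans (<⇒≤ i<x) (m≤n+m x m)))
      target : Up (arity l + j) m y q → arity l < y
      target (low _ refl) = l<q
      target (high i<y _) = ≤-<-trans (m≤m+n _ j) i<y
    colourless (crossing-right x y z) = K-crossing-right x y z
    colourless (crossing-left x y z)  = K-crossing-left x y z

  go : Cut (arity l) p q → arcs g (node h l r′) p q ≡ K p q
  go (left q≤l) =
    trans (arcs-left g h l r′ {p} q≤l) (trans (sym (arcs-left g h l r {p} q≤l))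
    (sym (K-outside p q (low (≤-trans (<⇒≤ p<q) q≤i) refl) (low q≤i refl) p<q
           λ { (_ , refl) → 1+n≰n q≤i })))
    where q≤i = ≤-trans q≤l (m≤m+n _ j)
  go (right x y refl refl x<y) =
    trans (arcs-right g h l r′ x<y)
    (trans (graft-arcs h r j t e j< x y x<y y≤)
    (sym (composite-local (arity l) (config g s) (config h r) (config β t) (config β t) e e j<
           agree (λ _ _ _ _ → refl) x y x<y y≤)))
    where
    y≤ : y ≤ arity r + m
    y≤ = +-cancelˡ-≤ (arity l) y _ q≤′
    agree : ∀ p q → p < q → q ≤ arity r → arcs g s (arity l + p) (arity l + q) ≡ arcs h r p q
    agree p q p<q _ = arcs-right g h l r p<q
  go (across p<l l<q) with p ≟ 0 | q ≟ m + (arity l + arity r)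
  ... | yes refl | yes refl =
        trans (cong (arcs g (node h l r′) 0) (sym size≡))
        (trans (arcs-base g h l r′) (trans (sym (arcs-base g h l r))
        (sym (K-outside 0 (arity l + arity r) (low z≤n refl)
           (high (+-monoʳ-< (arity l) j<) refl)
           (≤-trans (0<arity l) (m≤m+n _ _))
           λ { (e , _) → <-irrefl (sym (m+n≡0⇒m≡0 (arity l) (sym e))) (0<arity l) }))))
  ... | yes refl | no q≢ = interior p<l l<q (q≢ ∘ proj₂)
  ... | no p≢    | _     = interior p<l l<q (p≢ ∘ proj₁)

-- π is a morphism onto the generated suboperad

≈C-refl : ∀ {C} → C ≈C C
≈C-refl = refl , λ _ _ _ _ _ → refl

≈C-sym : ∀ {C D} → C ≈C D → D ≈C C
≈C-sym (e , f) = sym e , λ i j 1≤i i<j j≤ → sym (f i j 1≤i i<j (subst (λ n → j ≤ suc n) (sym e) j≤))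

≈C-trans : ∀ {C D E} → C ≈C D → D ≈C E → C ≈C E
≈C-trans (e , f) (e′ , f′) = trans e e′ ,
  λ i j 1≤i i<j j≤ → trans (f i j 1≤i i<j j≤) (f′ i j 1≤i i<j (subst (λ n → j ≤ suc n) e j≤))

size-composite : ∀ C i D {m} → size D ≡ suc m → size (C ∘C⟨ i ⟩ D) ≡ size C + m
size-composite C i D {m} e = trans (cong (λ n → size C + n ∸ 1) e) (cong (_∸ 1) (+-suc (size C) m))

≈C-composite : ∀ {C C′ D D′ i m} → size D ≡ suc m → i < size C → C ≈C C′ → D ≈C D′ →
               (C ∘C⟨ suc i ⟩ D) ≈C (C′ ∘C⟨ suc i ⟩ D′)
≈C-composite {C} {C′} {D} {D′} {i} {m} e i< (eC , fC) (eD , fD) =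
  cong₂ (λ x y → x + y ∸ 1) eC eD , agree
  where
  agree : ∀ p q → 1 ≤ p → p < q → q ≤ suc (size (C ∘C⟨ suc i ⟩ D)) →
          col (C ∘C⟨ suc i ⟩ D) p q ≡ col (C′ ∘C⟨ suc i ⟩ D′) p q
  agree (suc p) (suc q) _ (s≤s p<q) (s≤s q≤) =
    composite-local 0 C C′ D D′ e (trans (sym eD) e) i<
      (λ x y x<y y≤ → fC (suc x) (suc y) z<s (s≤s x<y) (s≤s y≤))
      (λ x y x<y y≤ → fD (suc x) (suc y) z<s (s≤s x<y) (s≤s (subst (y ≤_) (sym e) y≤)))
      p q p<q (subst (q ≤_) (size-composite C (suc i) D e) q≤)

graft-config : ∀ s i t → i < arity s →
  config β (s ∘T⟨ suc i ⟩ t) ≈C (config β s ∘C⟨ suc i ⟩ config β t)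
graft-config s i t i< with arity-suc t
... | m , e = trans arity≡ (sym (size-composite (config β s) (suc i) (config β t) e)) ,
    λ { (suc p) (suc q) _ (s≤s p<q) (s≤s q≤) →
        graft-arcs β s i t e i< p q p<q (subst (q ≤_) arity≡ q≤) }
  where arity≡ = arity-graft s i t e i<

≈C-size-2 : ∀ {f h} → f 1 2 ≡ h 1 2 → f 1 3 ≡ h 1 3 → f 2 3 ≡ h 2 3 →
            mkConfig 2 f ≈C mkConfig 2 h
≈C-size-2 {f} {h} e₁₂ e₁₃ e₂₃ = refl , agree
  where
  agree : ∀ p q → 1 ≤ p → p < q → q ≤ 3 → f p q ≡ h p q
  agree 1 2 _ _ _ = e₁₂
  agree 1 3 _ _ _ = e₁₃
  agree 2 3 _ _ _ = e₂₃
  agree (suc p) 1 _ (s≤s ()) _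
  agree (suc (suc p)) 2 _ (s≤s (s≤s ())) _
  agree (suc (suc (suc p))) 3 _ (s≤s (s≤s (s≤s ()))) _
  agree _ (suc (suc (suc (suc q)))) _ _ (s≤s (s≤s (s≤s ())))

config-gen : ∀ g → πgen g ≈C config β (gen g)
config-gen α = ≈C-size-2 refl refl refl
config-gen β = ≈C-size-2 refl refl refl

-- Both gluings in `π` are graftings: `node g l r` computes from `gen g` by grafting `r` on the
-- second leaf and then `l` on the first, so `graft-config` applies twice.
π≈config : ∀ t → π t ≈C config β t
π≈config leaf = refl , agree
  where
  agree : ∀ p q → 1 ≤ p → p < q → q ≤ 2 → col unitC p q ≡ blue
  agree 1 2 _ _ _ = refl
  agree (suc p) 1 _ (s≤s ()) _
  agree (suc (suc p)) 2 _ (s≤s (s≤s ())) _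
  agree _ (suc (suc (suc q))) _ _ (s≤s (s≤s ()))
π≈config (node g l r) =
  ≈C-trans (≈C-composite (trans (proj₁ (π≈config l)) (proj₂ (arity-suc l))) 0<
             (≈C-trans (≈C-composite (trans (proj₁ (π≈config r)) (proj₂ (arity-suc r))) (1<size g)
                          (config-gen g) (π≈config r))
                       (≈C-sym (graft-config (gen g) 1 r (s≤s (s≤s z≤n)))))
             (π≈config l))
           (≈C-sym (graft-config (node g leaf r) 0 l z<s))
  where
  1<size : ∀ g → 1 < size (πgen g)
  1<size α = s≤s (s≤s z≤n)
  1<size β = s≤s (s≤s z≤n)
  0< : 0 < size (πgen g ∘C⟨ 2 ⟩ π r)
  0< = subst (0 <_) (sym (size-composite (πgen g) 2 (π r) (trans (proj₁ (π≈config r)) (proj₂ (arity-suc r)))))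
         (≤-trans (<⇒≤ (1<size g)) (m≤m+n _ _))

π-graft : ∀ s i t → i < arity s → π (s ∘T⟨ suc i ⟩ t) ≈C (π s ∘C⟨ suc i ⟩ π t)
π-graft s i t i< =
  ≈C-trans (π≈config (s ∘T⟨ suc i ⟩ t))
  (≈C-trans (graft-config s i t i<)
  (≈C-composite (proj₂ (arity-suc t)) i< (≈C-sym (π≈config s)) (≈C-sym (π≈config t))))

size-π : ∀ t → size (π t) ≡ arity t
size-π t = proj₁ (π≈config t)

≈C-size-4 : ∀ {f h} → f 1 2 ≡ h 1 2 → f 1 3 ≡ h 1 3 → f 1 4 ≡ h 1 4 → f 1 5 ≡ h 1 5 →
            f 2 3 ≡ h 2 3 → f 2 4 ≡ h 2 4 → f 2 5 ≡ h 2 5 →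
            f 3 4 ≡ h 3 4 → f 3 5 ≡ h 3 5 → f 4 5 ≡ h 4 5 →
            mkConfig 4 f ≈C mkConfig 4 h
≈C-size-4 {f} {h} e₁₂ e₁₃ e₁₄ e₁₅ e₂₃ e₂₄ e₂₅ e₃₄ e₃₅ e₄₅ = refl , agree
  where
  agree : ∀ p q → 1 ≤ p → p < q → q ≤ 5 → f p q ≡ h p q
  agree 1 2 _ _ _ = e₁₂
  agree 1 3 _ _ _ = e₁₃
  agree 1 4 _ _ _ = e₁₄
  agree 1 5 _ _ _ = e₁₅
  agree 2 3 _ _ _ = e₂₃
  agree 2 4 _ _ _ = e₂₄
  agree 2 5 _ _ _ = e₂₅
  agree 3 4 _ _ _ = e₃₄
  agree 3 5 _ _ _ = e₃₅
  agree 4 5 _ _ _ = e₄₅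
  agree (suc p) 1 _ (s≤s ()) _
  agree (suc (suc p)) 2 _ (s≤s (s≤s ())) _
  agree (suc (suc (suc p))) 3 _ (s≤s (s≤s (s≤s ()))) _
  agree (suc (suc (suc (suc p)))) 4 _ (s≤s (s≤s (s≤s (s≤s ())))) _
  agree (suc (suc (suc (suc (suc p))))) 5 _ (s≤s (s≤s (s≤s (s≤s (s≤s ()))))) _
  agree _ (suc (suc (suc (suc (suc (suc q)))))) _ _ (s≤s (s≤s (s≤s (s≤s (s≤s ())))))

≡F⇒≈C : ∀ {s t} → s ≡F t → π s ≈C π t
-- Both sides are pentagons, whose ten arcs are compared by computation.
≡F⇒≈C rel-α = ≈C-size-4 refl refl refl refl refl refl refl refl refl refl
≡F⇒≈C rel-β = ≈C-size-4 refl refl refl refl refl refl refl refl refl refl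
≡F⇒≈C ≡F-refl = ≈C-refl
≡F⇒≈C (≡F-sym e) = ≈C-sym (≡F⇒≈C e)
≡F⇒≈C (≡F-trans e e′) = ≈C-trans (≡F⇒≈C e) (≡F⇒≈C e′)
≡F⇒≈C (≡F-comp {s} {s′} {t} {t′} (suc i) _ i≤ e e′) =
  ≈C-trans (π-graft s i t i≤)
  (≈C-trans (≈C-composite (trans (size-π t) (proj₂ (arity-suc t))) (subst (i <_) (sym (size-π s)) i≤)
               (≡F⇒≈C e) (≡F⇒≈C e′))
  (≈C-sym (π-graft s′ i t′ (subst (i <_) arity≡ i≤))))
  -- Equivalent trees have the same arity, read off from their configurations, so the bound on `i`
  -- passes from `s` to `s′`.
  where arity≡ = trans (sym (size-π s)) (trans (proj₁ (≡F⇒≈C e)) (size-π s′))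

π-InGen : ∀ t → InGen (π t)
π-InGen leaf = gen-unit
π-InGen (node g l r) =
  gen-comp 1 ≤-refl
    (subst (1 ≤_) (sym (size-composite (πgen g) 2 (π r) (trans (size-π r) (proj₂ (arity-suc r)))))
      (≤-trans (≤-trans (n≤1+n 1) (2≤size g)) (m≤m+n _ _)))
    (gen-comp 2 (s≤s z≤n) (2≤size g) (generator g) (π-InGen r)) (π-InGen l)
  where
  generator : ∀ g → InGen (πgen g)
  generator α = gen-aab
  generator β = gen-bba
  2≤size : ∀ g → 2 ≤ size (πgen g)
  2≤size α = ≤-refl
  2≤size β = ≤-refl

InGen⇒π : ∀ C → InGen C → Σ Tree (λ t → π t ≈C C)
InGen⇒π _ gen-unit = leaf , ≈C-refl
InGen⇒π _ gen-aab = gen α , ≈C-trans (π≈config (gen α)) (≈C-sym (config-gen α))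
InGen⇒π _ gen-bba = gen β , ≈C-trans (π≈config (gen β)) (≈C-sym (config-gen β))
InGen⇒π _ (gen-comp {C} {D} (suc i) _ i≤ c d) with InGen⇒π C c | InGen⇒π D d
... | s , e | t , e′ = s ∘T⟨ suc i ⟩ t ,
  ≈C-trans (π-graft s i t (subst (i <_) (size-π s) i<s))
           (≈C-composite (trans (size-π t) (proj₂ (arity-suc t))) i<s e e′)
  where i<s = subst (i <_) (sym (proj₁ e)) i≤

-- Bubbles and their normal forms

≡F-node : ∀ g {l l′ r r′} → l ≡F l′ → r ≡F r′ → node g l r ≡F node g l′ r′
≡F-node g l≡ r≡ = ≡F-comp 1 z<s z<s (≡F-comp 2 z<s (s≤s (s≤s z≤n)) (≡F-refl {gen g}) r≡) l≡

-- The defining relation with trees substituted for its four leaves. They are grafted from right to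
-- left, so that the indices of the leaves still to be filled do not move.
≡F-rotate : ∀ g x y z w →
  node g x (node g (node (flip g) y z) w) ≡F node g (node (flip g) (node g x y) z) w
≡F-rotate g x y z w =
  ≡F-comp 1 z<s z<s (≡F-comp 2 z<s (s≤s (s≤s z≤n)) (≡F-comp 3 z<s (s≤s (s≤s (s≤s z≤n)))
    (≡F-comp 4 z<s (s≤s (s≤s (s≤s (s≤s z≤n)))) (generator g) (≡F-refl {w}))
    (≡F-refl {z})) (≡F-refl {y})) (≡F-refl {x})
  where
  generator : ∀ g → node g leaf (node g (node (flip g) leaf leaf) leaf) ≡F
                    node g (node (flip g) (node g leaf leaf) leaf) leaf
  generator α = rel-α
  generator β = rel-β

-- Only the shape of a bubble is stored, since the generator in root position determines all the
-- others; `eval` puts them back.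
data Bubble : Set where
  letter : Tree → Bubble
  node   : Bubble → Bubble → Bubble

eval : Gen₂ → Bubble → Tree
eval g (letter t) = t
eval g (node l r) = node g (eval (flip g) l) (eval g r)

bubble : Gen₂ → Tree → Bubble
bubble α (node α l r) = node (bubble β l) (bubble α r)
bubble β (node β l r) = node (bubble α l) (bubble β r)
bubble _ t            = letter t

eval-bubble : ∀ g t → eval g (bubble g t) ≡ t
eval-bubble α leaf         = refl
eval-bubble β leaf         = refl
eval-bubble α (node α l r) = cong₂ (node α) (eval-bubble β l) (eval-bubble α r)
eval-bubble α (node β l r) = refl
eval-bubble β (node α l r) = refl
eval-bubble β (node β l r) = cong₂ (node β) (eval-bubble α l) (eval-bubble β r)

-- The generator paired with a tree is its position in the bubble: its `slot` is the colour of the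
-- edge onto which the tree is glued.
Word : Set
Word = List (Gen₂ × Tree)

word : Gen₂ → Bubble → Word
word g (letter t) = (g , t) ∷ []
word g (node l r) = word (flip g) l ++ word g r

-- The normal form of `node s t` for normal `s` and `t`. The last clause uses the relation from left
-- to right and goes on with `node s y`, the only place where a new instance of its left side can
-- arise.
cat : Bubble → Bubble → Bubble
cat s (letter t)            = node s (letter t)
cat s (node (letter t) r)   = node s (node (letter t) r)
cat s (node (node y z) r)   = node (node (cat s y) z) r

normal : Bubble → Bubble
normal (letter t) = letter t
normal (node l r) = cat (normal l) (normal r)

eval-cat : ∀ g s t → eval g (cat s t) ≡F node g (eval (flip g) s) (eval g t)
eval-cat g s (letter t) = ≡F-refl
eval-cat g s (node (letter t) r) = ≡F-refl
eval-cat α s (node (node y z) r) = ≡F-trans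
  (≡F-node α (≡F-node β (eval-cat α s y) ≡F-refl) ≡F-refl)
  (≡F-sym (≡F-rotate α (eval β s) (eval α y) (eval β z) (eval α r)))
eval-cat β s (node (node y z) r) = ≡F-trans
  (≡F-node β (≡F-node α (eval-cat β s y) ≡F-refl) ≡F-refl)
  (≡F-sym (≡F-rotate β (eval α s) (eval β y) (eval α z) (eval β r)))

eval-normal : ∀ g t → eval g (normal t) ≡F eval g t
eval-normal g (letter t) = ≡F-refl
eval-normal g (node l r) = ≡F-trans (eval-cat g (normal l) (normal r))
                                    (≡F-node g (eval-normal (flip g) l) (eval-normal g r))

-- In `cat` the prepended bubble has the position opposite to that of the root. A bubble in the
-- position of the root itself is prepended to the left child, whose position is the opposite one.
graftˡ : Bubble → Bubble → Bubble
-- A default value. The fold in `push-same` starts from a node, and the one in `push-flip` inserts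
-- the last letter of the word by `cat`, so both meet only nodes here.
graftˡ s (letter t) = letter t
graftˡ s (node l r) = node (cat s l) r

-- Associativity of insertion at the left. As `cat q l` is never a letter, `cat p` always takes its
-- recursive clause, and the two insertions descend along the same path.
cat-cat : ∀ p q l r → cat p (node (cat q l) r) ≡ node (cat (cat p q) l) r
cat-cat p q (letter t)          r = refl
cat-cat p q (node (letter t) l) r = refl
cat-cat p q (node (node y z) l) r = cong (λ b → node (node b l) r) (cat-cat p q y z)

-- Prepends a letter to the word of a bubble with root in position g.
push : Gen₂ → Gen₂ × Tree → Bubble → Bubble
push α (α , t) = graftˡ (letter t)
push α (β , t) = cat (letter t)
push β (α , t) = cat (letter t)
push β (β , t) = graftˡ (letter t)

flip-flip : ∀ g → flip (flip g) ≡ g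
flip-flip α = refl
flip-flip β = refl

module _ where
  open ≡-Reasoning

  -- These show that the normal form is a function of the word. They are proved by mutual induction
  -- because the two children of a bubble have opposite positions: the letters of one child are
  -- inserted at the root, those of the other into the left child, and `cat-cat` merges both
  -- insertions.
  push-flip : ∀ g s t → foldr (push g) t (word (flip g) s) ≡ cat (normal s) t
  push-same : ∀ g s l r → foldr (push g) (node l r) (word g s) ≡ node (cat (normal s) l) r

  push-flip α (letter x) t = refl
  push-flip β (letter x) t = refl
  push-flip g (node p q) t = begin
    foldr (push g) t (word (flip (flip g)) p ++ word (flip g) q)
      ≡⟨ foldr-++ (push g) t (word (flip (flip g)) p) (word (flip g) q) ⟩
    foldr (push g) (foldr (push g) t (word (flip g) q)) (word (flip (flip g)) p)
      ≡⟨ cong₂ (λ u h → foldr (push g) u (word h p)) (push-flip g q t) (flip-flip g) ⟩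
    foldr (push g) (cat (normal q) t) (word g p)
      ≡⟨ push-cat t ⟩
    cat (cat (normal p) (normal q)) t ∎
    where
    -- `push-same` requires a node; the cases on `t` serve to exhibit `cat (normal q) t` as one.
    push-cat : ∀ t → foldr (push g) (cat (normal q) t) (word g p) ≡ cat (cat (normal p) (normal q)) t
    push-cat (letter x)          = push-same g p (normal q) (letter x)
    push-cat (node (letter x) r) = push-same g p (normal q) (node (letter x) r)
    push-cat (node (node y z) r) =
      trans (push-same g p (node (cat (normal q) y) z) r)
            (cong (λ b → node b r) (cat-cat (normal p) (normal q) y z))

  push-same α (letter x) l r = refl
  push-same β (letter x) l r = refl
  push-same g (node p q) l r = begin
    foldr (push g) (node l r) (word (flip g) p ++ word g q)
      ≡⟨ foldr-++ (push g) (node l r) (word (flip g) p) (word g q) ⟩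
    foldr (push g) (foldr (push g) (node l r) (word g q)) (word (flip g) p)
      ≡⟨ cong (λ u → foldr (push g) u (word (flip g) p)) (push-same g q l r) ⟩
    foldr (push g) (node (cat (normal q) l) r) (word (flip g) p)
      ≡⟨ push-flip g p _ ⟩
    cat (normal p) (node (cat (normal q) l) r)
      ≡⟨ cat-cat (normal p) (normal q) l r ⟩
    node (cat (cat (normal p) (normal q)) l) r ∎

-- Corresponding letters of two bubbles will be known to be equivalent, not equal, so normal forms
-- are compared up to equivalence of their letters.
data _~_ : Bubble → Bubble → Set where
  letter : ∀ {s t} → s ≡F t → letter s ~ letter t
  node   : ∀ {l l′ r r′} → l ~ l′ → r ~ r′ → node l r ~ node l′ r′

~-cat : ∀ {s s′ t t′} → s ~ s′ → t ~ t′ → cat s t ~ cat s′ t′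
~-cat e (letter x)          = node e (letter x)
~-cat e (node (letter x) r) = node e (node (letter x) r)
~-cat e (node (node y z) r) = node (node (~-cat e y) z) r

~-graftˡ : ∀ {s s′ t t′} → s ~ s′ → t ~ t′ → graftˡ s t ~ graftˡ s′ t′
~-graftˡ e (letter x) = letter x
~-graftˡ e (node l r) = node (~-cat e l) r

~-eval : ∀ g {s t} → s ~ t → eval g s ≡F eval g t
~-eval g (letter e) = e
~-eval g (node l r) = ≡F-node g (~-eval (flip g) l) (~-eval g r)

_≈L_ : Gen₂ × Tree → Gen₂ × Tree → Set
(g , s) ≈L (h , t) = g ≡ h × s ≡F t

~-push : ∀ g {x y s t} → x ≈L y → s ~ t → push g x s ~ push g y t
~-push α {α , _} (refl , e) = ~-graftˡ (letter e)
~-push α {β , _} (refl , e) = ~-cat (letter e)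
~-push β {α , _} (refl , e) = ~-cat (letter e)
~-push β {β , _} (refl , e) = ~-graftˡ (letter e)

~-foldr : ∀ g {u v s t} → Pointwise _≈L_ u v → s ~ t → foldr (push g) s u ~ foldr (push g) t v
~-foldr g []       e = e
~-foldr g (x ∷ xs) e = ~-push g x (~-foldr g xs e)

-- A dummy last letter turns the normal form of s into a value of push on its word.
word-injective : ∀ g s t → Pointwise _≈L_ (word g s) (word g t) → eval g s ≡F eval g t
word-injective g s t w with
  subst₂ _~_ (append s) (append t) (~-foldr (flip g) w (letter (≡F-refl {leaf})))
  where
  append : ∀ s → foldr (push (flip g)) (letter leaf) (word g s) ≡ node (normal s) (letter leaf)
  append s = trans (cong (λ h → foldr (push (flip g)) (letter leaf) (word h s)) (sym (flip-flip g)))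
                   (push-flip (flip g) s (letter leaf))
... | node e _ = ≡F-trans (≡F-sym (eval-normal g s)) (≡F-trans (~-eval g e) (eval-normal g t))

-- Recovering words from colours

total : Word → ℕ
total []            = 0
total ((_ , t) ∷ w) = arity t + total w

word-arcs : Word → ℕ → ℕ → Colour
word-arcs []            = λ _ _ → none
word-arcs ((g , t) ∷ w) = juxtapose (arity t) (arcs g t) (word-arcs w)

Agree : ℕ → (ℕ → ℕ → Colour) → (ℕ → ℕ → Colour) → Set
Agree n f h = ∀ p q → p < q → q ≤ n → f p q ≡ h p q

total-++ : ∀ u v → total (u ++ v) ≡ total u + total v
total-++ []            v = refl
total-++ ((_ , t) ∷ u) v = trans (cong (arity t +_) (total-++ u v)) (sym (+-assoc (arity t) (total u) (total v)))

total-word : ∀ g s → total (word g s) ≡ arity (eval g s)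
total-word g (letter t) = +-identityʳ (arity t)
total-word g (node l r) = trans (total-++ (word (flip g) l) (word g r))
                                (cong₂ _+_ (total-word (flip g) l) (total-word g r))

juxtapose-cong : ∀ {f f′ h h′} n m → Agree n f f′ → Agree m h h′ →
                 Agree (n + m) (juxtapose n f h) (juxtapose n f′ h′)
juxtapose-cong {f} {f′} {h} {h′} n m F H p q p<q q≤ with cut n p<q
... | left q≤n = trans (juxtapose-left f h q≤n) (trans (F p q p<q q≤n) (sym (juxtapose-left f′ h′ q≤n)))
... | across p<n n<q = trans (juxtapose-across f h p<n n<q) (sym (juxtapose-across f′ h′ p<n n<q))
... | right x y refl refl x<y =
  trans (juxtapose-right f h n x<y)
  (trans (H x y x<y (+-cancelˡ-≤ n y m q≤)) (sym (juxtapose-right f′ h′ n x<y)))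

juxtapose-assoc : ∀ f h k n m {p q} → p < q →
  juxtapose n f (juxtapose m h k) p q ≡ juxtapose (n + m) (juxtapose n f h) k p q
juxtapose-assoc f h k n m {p} {q} p<q with cut n p<q | cut (n + m) p<q
... | left q≤n | _ = trans (juxtapose-left f (juxtapose m h k) q≤n)
  (sym (trans (juxtapose-left (juxtapose n f h) k (≤-trans q≤n (m≤m+n n m))) (juxtapose-left f h q≤n)))
... | across p<n n<q | left q≤ = trans (juxtapose-across f (juxtapose m h k) p<n n<q)
  (sym (trans (juxtapose-left (juxtapose n f h) k q≤) (juxtapose-across f h p<n n<q)))
... | across p<n n<q | across p< <q = trans (juxtapose-across f (juxtapose m h k) p<n n<q)
  (sym (juxtapose-across (juxtapose n f h) k p< <q))
... | across p<n n<q | right x _ refl _ _ = contradiction p<n (≤⇒≯ (≤-trans (m≤m+n n m) (m≤m+n _ x)))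
... | right x y refl refl x<y | left q≤ = trans (juxtapose-right f (juxtapose m h k) n x<y)
  (trans (juxtapose-left h k (+-cancelˡ-≤ n y m q≤))
  (sym (trans (juxtapose-left (juxtapose n f h) k q≤) (juxtapose-right f h n x<y))))
... | right x y refl refl x<y | across p< <q = trans (juxtapose-right f (juxtapose m h k) n x<y)
  (trans (juxtapose-across h k (+-cancelˡ-< n x m p<) (+-cancelˡ-< n m y <q))
  (sym (juxtapose-across (juxtapose n f h) k p< <q)))
... | right x y refl refl x<y | right x′ y′ e e′ x′<y′ with
      +-cancelˡ-≡ n x (m + x′) (trans e (+-assoc n m x′)) | +-cancelˡ-≡ n y (m + y′) (trans e′ (+-assoc n m y′))
...   | refl | refl = trans (juxtapose-right f (juxtapose m h k) n x<y)
  (trans (juxtapose-right h k m x′<y′)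
  (sym (trans (cong₂ (juxtapose (n + m) (juxtapose n f h) k) e e′) (juxtapose-right (juxtapose n f h) k (n + m) x′<y′))))

word-arcs-++ : ∀ u v {p q} → p < q →
  word-arcs (u ++ v) p q ≡ juxtapose (total u) (word-arcs u) (word-arcs v) p q
word-arcs-++ [] v {p} {suc q} p<q = refl
word-arcs-++ ((g , t) ∷ u) v {p} {q} p<q =
  trans (juxtapose-cong {arcs g t} {arcs g t} {word-arcs (u ++ v)} {juxtapose (total u) (word-arcs u) (word-arcs v)} (arity t) q
           (λ _ _ _ _ → refl) (λ x y x<y _ → word-arcs-++ u v x<y) p q p<q (m≤n+m q (arity t)))
        (juxtapose-assoc (arcs g t) (word-arcs u) (word-arcs v) (arity t) (total u) p<q)

glue-same : ∀ g → glue (slot g) (base g) ≡ none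
glue-same α = refl
glue-same β = refl

-- A node glued onto a slot of its own generator leaves an uncoloured arc there, which is just what
-- `juxtapose` assigns to an arc across the two children.
arcs-same : ∀ g l r {p q} → p < q →
  arcs g (node g l r) p q ≡ juxtapose (arity l) (arcs (flip g) l) (arcs g r) p q
arcs-same g l r {p} {q} p<q with p ≟ 0 | q ≟ arity l + arity r
... | yes refl | yes refl = trans (arcs-base g g l r) (trans (glue-same g)
        (sym (juxtapose-across (arcs (flip g) l) (arcs g r) (0<arity l) (m<m+n (arity l) (0<arity r)))))
... | yes _ | no q≢ = arcs-inner g g l r {p} {q} (q≢ ∘ proj₂)
... | no p≢ | _     = arcs-inner g g l r {p} {q} (p≢ ∘ proj₁)

-- By `arcs-same` at every node of the bubble, only the arcs belonging to the letters remain
-- visible.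
arcs-word : ∀ g s → Agree (arity (eval g s)) (arcs g (eval g s)) (word-arcs (word g s))
arcs-word g (letter t) p q p<q q≤ = sym (juxtapose-left (arcs g t) (word-arcs []) q≤)
arcs-word g (node l r) p q p<q q≤ = begin
  arcs g (node g l′ r′) p q
    ≡⟨ arcs-same g l′ r′ p<q ⟩
  juxtapose (arity l′) (arcs (flip g) l′) (arcs g r′) p q
    ≡⟨ juxtapose-cong (arity l′) (arity r′) (arcs-word (flip g) l) (arcs-word g r) p q p<q q≤ ⟩
  juxtapose (arity l′) (word-arcs (word (flip g) l)) (word-arcs (word g r)) p q
    ≡⟨ cong (λ n → juxtapose n (word-arcs (word (flip g) l)) (word-arcs (word g r)) p q)
            (total-word (flip g) l) ⟨
  juxtapose (total (word (flip g) l)) (word-arcs (word (flip g) l)) (word-arcs (word g r)) p q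
    ≡⟨ word-arcs-++ (word (flip g) l) (word g r) p<q ⟨
  word-arcs (word (flip g) l ++ word g r) p q ∎
  where
  open ≡-Reasoning
  l′ = eval (flip g) l
  r′ = eval g r

-- The second component is not rooted at g, which would extend the bubble.
data Letter : Gen₂ × Tree → Set where
  leaf : ∀ {g} → Letter (g , leaf)
  node : ∀ {g l r} → Letter (g , node (flip g) l r)

word-letters : ∀ g t → All Letter (word g (bubble g t))
word-letters α leaf         = leaf ∷ []
word-letters β leaf         = leaf ∷ []
word-letters α (node α l r) = ++⁺ (word-letters β l) (word-letters α r)
word-letters α (node β l r) = node ∷ []
word-letters β (node α l r) = node ∷ []
word-letters β (node β l r) = ++⁺ (word-letters α l) (word-letters β r)

≤-Letter : ℕ → Gen₂ × Tree → Set
≤-Letter k (_ , t) = arity t ≤ k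

word-≤ : ∀ k g t → arity t ≤ k → All (≤-Letter k) (word g (bubble g t))
word-≤ k α leaf         t≤ = t≤ ∷ []
word-≤ k β leaf         t≤ = t≤ ∷ []
word-≤ k α (node α l r) t≤ = ++⁺ (word-≤ k β l (≤-trans (m≤m+n _ _) t≤)) (word-≤ k α r (≤-trans (m≤n+m _ _) t≤))
word-≤ k α (node β l r) t≤ = t≤ ∷ []
word-≤ k β (node α l r) t≤ = t≤ ∷ []
word-≤ k β (node β l r) t≤ = ++⁺ (word-≤ k α l (≤-trans (m≤m+n _ _) t≤)) (word-≤ k β r (≤-trans (m≤n+m _ _) t≤))

-- In the position of its own root a tree has a bubble with at least one node, so every letter lies
-- in one of the two children. This makes the induction in `arcs-injective` decrease.
word-< : ∀ k g l r → arity (node g l r) ≤ suc k → All (≤-Letter k) (word g (bubble g (node g l r)))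
word-< k g l r le = split g
  where
  l≤ : arity l ≤ k
  l≤ = s≤s⁻¹ (≤-trans (m<m+n (arity l) (0<arity r)) le)
  r≤ : arity r ≤ k
  r≤ = s≤s⁻¹ (≤-trans (m<n+m (arity r) (0<arity l)) le)
  split : ∀ g → All (≤-Letter k) (word g (bubble g (node g l r)))
  split α = ++⁺ (word-≤ k β l l≤) (word-≤ k α r r≤)
  split β = ++⁺ (word-≤ k α l l≤) (word-≤ k β r r≤)

Same : Gen₂ × Tree → Gen₂ × Tree → Set
Same (g , s) (h , t) = g ≡ h × arity s ≡ arity t × Agree (arity s) (arcs g s) (arcs h t)

-- The colour of the top arc of a letter of arity `n`. On a blue slot an edge and a diagonal are
-- both blue; on an uncoloured slot an edge is uncoloured and a diagonal is red.
tint : Gen₂ → ℕ → Colour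
tint α n = if n ≤ᵇ 1 then none else red
tint β n = blue

tint-injective : ∀ g h n → tint g n ≡ tint h n → g ≡ h
tint-injective α α n e = refl
tint-injective β β n e = refl
tint-injective α β n e with n ≤ᵇ 1
tint-injective α β n () | true
tint-injective α β n () | false
tint-injective β α n e with n ≤ᵇ 1
tint-injective β α n () | true
tint-injective β α n () | false

tint-coloured : ∀ g {n} → 1 < n → tint g n ≢ none
tint-coloured α 1<n e with trans (sym e) (if-false (≤ᵇ-false 1<n))
... | ()

arcs-letter : ∀ {g t} → Letter (g , t) → arcs g t 0 (arity t) ≡ tint g (arity t)
arcs-letter {α} leaf = refl
arcs-letter {β} leaf = refl
arcs-letter {α} (node {l = l} {r}) =
  trans (arcs-base α β l r) (sym (if-false (≤ᵇ-false (+-mono-≤ (0<arity l) (0<arity r)))))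
arcs-letter {β} (node {l = l} {r}) = arcs-base β α l r

-- An arc issued from the source of the first letter and longer than it is uncoloured.
first-letter-≤ : ∀ {g s h t} u v → Letter (h , t) →
  total ((g , s) ∷ u) ≡ total ((h , t) ∷ v) →
  Agree (total ((g , s) ∷ u)) (word-arcs ((g , s) ∷ u)) (word-arcs ((h , t) ∷ v)) →
  arity t ≤ arity s
first-letter-≤ {g} {s} {h} {t} u v L e A = ≮⇒≥ λ s<t →
  tint-coloured h (≤-<-trans (0<arity s) s<t)
    (trans (sym (arcs-letter L))
    (trans (sym (juxtapose-left (arcs h t) (word-arcs v) ≤-refl))
    (trans (sym (A 0 (arity t) (0<arity t) (subst (arity t ≤_) (sym e) (m≤m+n _ _))))
           (juxtapose-across (arcs g s) (word-arcs u) (0<arity s) s<t))))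

-- Letters are split off from the left. Used in both directions, `first-letter-≤` shows that the
-- first letters have the same arity; the colour of their common top arc then yields the position by
-- `tint-injective`.
word-arcs-injective : ∀ u v → All Letter u → All Letter v → total u ≡ total v →
  Agree (total u) (word-arcs u) (word-arcs v) → Pointwise Same u v
word-arcs-injective [] [] _ _ _ _ = []
word-arcs-injective [] ((_ , t) ∷ v) _ _ e _ =
  contradiction (sym e) (m<n⇒n≢0 (≤-trans (0<arity t) (m≤m+n _ _)))
word-arcs-injective ((_ , s) ∷ u) [] _ _ e _ =
  contradiction e (m<n⇒n≢0 (≤-trans (0<arity s) (m≤m+n _ _)))
word-arcs-injective ((g , s) ∷ u) ((h , t) ∷ v) (L ∷ Ls) (M ∷ Ms) e A =
  (tint-injective g h (arity s) tint≡ , same , agree) ∷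
  word-arcs-injective u v Ls Ms total≡ λ p q p<q q≤ →
    trans (sym (juxtapose-right (arcs g s) (word-arcs u) (arity s) p<q))
    (trans (A (arity s + p) (arity s + q) (+-monoʳ-< (arity s) p<q) (+-monoʳ-≤ (arity s) q≤))
    (trans (cong₂ (word-arcs ((h , t) ∷ v)) (cong (_+ p) same) (cong (_+ q) same))
           (juxtapose-right (arcs h t) (word-arcs v) (arity t) p<q)))
  where
  same : arity s ≡ arity t
  same = ≤-antisym
    (first-letter-≤ {h} {t} {g} {s} v u L (sym e) (λ p q p<q q≤ → sym (A p q p<q (subst (q ≤_) (sym e) q≤))))
    (first-letter-≤ {g} {s} {h} {t} u v M e A)
  total≡ : total u ≡ total v
  total≡ = +-cancelˡ-≡ (arity s) _ _ (trans e (cong (_+ total v) (sym same)))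
  agree : Agree (arity s) (arcs g s) (arcs h t)
  agree p q p<q q≤ =
    trans (sym (juxtapose-left (arcs g s) (word-arcs u) q≤))
    (trans (A p q p<q (≤-trans q≤ (m≤m+n _ _)))
           (juxtapose-left (arcs h t) (word-arcs v) (subst (q ≤_) same q≤)))
  tint≡ : tint g (arity s) ≡ tint h (arity s)
  tint≡ = trans (sym (arcs-letter L)) (trans (agree 0 (arity s) (0<arity s) ≤-refl)
    (trans (cong (arcs h t 0) same) (trans (arcs-letter M) (cong (tint h) (sym same)))))

-- Injectivity of the morphism modulo the congruence

glue-slot-injective : ∀ g h k → glue (slot g) (base h) ≡ glue (slot g) (base k) → h ≡ k
glue-slot-injective g α α _ = refl
glue-slot-injective g β β _ = refl
glue-slot-injective α α β ()
glue-slot-injective β α β ()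
glue-slot-injective α β α ()
glue-slot-injective β β α ()

arity-node-≢1 : ∀ g l r → arity (node g l r) ≢ 1
arity-node-≢1 g l r e = <-irrefl (sym e) (+-mono-≤ (0<arity l) (0<arity r))

-- The colour of the base reveals the common root generator `h`, the arcs reveal the word of the
-- bubble in position `h`, and the induction hypothesis makes corresponding letters equivalent. The
-- slot `g` is arbitrary because letters occur in both positions; the recursion is on the bound `k`
-- because they are reached through a list.
arcs-injective : ∀ k g s t → arity s ≤ k → arity s ≡ arity t →
                 Agree (arity s) (arcs g s) (arcs g t) → s ≡F t
arcs-injective k g leaf leaf _ _ _ = ≡F-refl
arcs-injective k g leaf (node h l r) _ e _ = contradiction (sym e) (arity-node-≢1 h l r)
arcs-injective k g (node h l r) leaf _ e _ = contradiction e (arity-node-≢1 h l r)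
arcs-injective zero g s@(node _ _ _) _ s≤ _ _ = contradiction s≤ (<⇒≱ (0<arity s))
arcs-injective (suc k) g s@(node h l r) t@(node h′ l′ r′) s≤ e A
  with glue-slot-injective g h h′
         (trans (sym (arcs-base g h l r))
         (trans (A 0 (arity s) (0<arity s) ≤-refl)
         (trans (cong (arcs g t 0) e) (arcs-base g h′ l′ r′))))
... | refl = subst₂ _≡F_ (eval-bubble h s) (eval-bubble h t)
    (word-injective h (bubble h s) (bubble h t) (letters (word-< k h l r s≤) words))
  where
  -- Moving both trees from slot `g` to slot `h` affects only the top arc, which becomes uncoloured
  -- in both since `h` is their root. The bubbles in position `h` are then visible through
  -- `arcs-bubble`.
  same-root : Agree (arity s) (arcs h s) (arcs h t)
  same-root p q p<q q≤ with p ≟ 0 | q ≟ arity s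
  ... | yes refl | yes refl = trans (arcs-base h h l r) (trans (sym (arcs-base h h l′ r′)) (cong (arcs h t 0) (sym e)))
  ... | yes refl | no q≢ = trans (arcs-slot h g s {p} {q} (q≢ ∘ proj₂) p<q q≤)
    (trans (A p q p<q q≤) (arcs-slot g h t {p} {q} (q≢ ∘ (λ z → trans z (sym e)) ∘ proj₂) p<q (subst (q ≤_) e q≤)))
  ... | no p≢ | _ = trans (arcs-slot h g s {p} {q} (p≢ ∘ proj₁) p<q q≤)
    (trans (A p q p<q q≤) (arcs-slot g h t {p} {q} (p≢ ∘ proj₁) p<q (subst (q ≤_) e q≤)))

  total-bubble : ∀ u → total (word h (bubble h u)) ≡ arity u
  total-bubble u = trans (total-word h (bubble h u)) (cong arity (eval-bubble h u))

  arcs-bubble : ∀ u → Agree (arity u) (arcs h u) (word-arcs (word h (bubble h u)))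
  arcs-bubble u = subst (λ v → Agree (arity v) (arcs h v) (word-arcs (word h (bubble h u))))
                        (eval-bubble h u) (arcs-word h (bubble h u))

  words : Pointwise Same (word h (bubble h s)) (word h (bubble h t))
  words = word-arcs-injective _ _ (word-letters h s) (word-letters h t)
    (trans (total-bubble s) (trans e (sym (total-bubble t))))
    λ p q p<q q≤ → let q≤s = subst (q ≤_) (total-bubble s) q≤ in
      trans (sym (arcs-bubble s p q p<q q≤s))
      (trans (same-root p q p<q q≤s) (arcs-bubble t p q p<q (subst (q ≤_) e q≤s)))

  letters : ∀ {u v} → All (≤-Letter k) u → Pointwise Same u v → Pointwise _≈L_ u v
  letters [] [] = []
  letters (x≤ ∷ u≤) ((refl , same , agree) ∷ w) =
    (refl , arcs-injective k _ _ _ x≤ same agree) ∷ letters u≤ w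

≈C⇒≡F : ∀ s t → π s ≈C π t → s ≡F t
≈C⇒≡F s t e with ≈C-trans (≈C-sym (π≈config s)) (≈C-trans e (π≈config t))
... | same , agree = arcs-injective (arity s) β s t ≤-refl same
  λ p q p<q q≤ → agree (suc p) (suc q) z<s (s≤s p<q) (s≤s q≤)

mainTheorem13 : ((s t : Tree) → (s ≡F t) ⇔ (π s ≈C π t))
    × ((t : Tree) → InGen (π t))
    × ((C : Config) → InGen C → Σ Tree (λ t → π t ≈C C))
mainTheorem13 = (λ s t → mk⇔ ≡F⇒≈C (≈C⇒≡F s t)) , π-InGen , InGen⇒π
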